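{- Let $f$ be a real-valued function whose domain contains $\mathbb{N}$ and such that $f(k+2)-f(k+1)>f(k+1)-f(k)$ for all $k\in\mathbb{N}$. If a graph $G$ maximizes $\Sigma_f$ over $\mathbb{G}(n,m)$, then $G$ is a threshold graph.
   Context: $\mathbb{N}=\{0,1,2,\dots\}$. Graphs are finite and simple, with vertex set $\{1,\dots,n\}$; $\mathbb{G}(n,m)$ is the set of graphs with $n$ vertices and $m$ edges. For a graph with degree sequence $d=(d_1,\dots,d_n)$ ($d_i$ the degree of vertex $i$), $\Sigma_f(d)=\sum_{i=1}^n f(d_i)$. A graph $G\in\mathbb{G}(n,m)$ maximizes $\Sigma_f$ over $\mathbb{G}(n,m)$ if its degree sequence attains the maximum of $\Sigma_f$ among all degree sequences of graphs in $\mathbb{G}(n,m)$. A graph is a threshold graph if it has the Chain Property: for any three distinct vertices $i,j,k$, if $d_i\ge d_j$ and $j$ and $k$ are adjacent, then $i$ and $k$ are also adjacent. -}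

module Defs where

open import Data.Nat.Base as ℕ using (ℕ)
import Data.Nat.Properties as ℕ
open import Data.Fin.Base as Fin using (Fin)
import Data.Fin.Properties as Fin
open import Data.List.Base using (List; allFin; cartesianProduct; filter; foldr; length; map)
open import Data.Product.Base using (Σ-syntax; ∃-syntax; _×_; _,_)
open import Data.Rational.Base as ℚ using (ℚ; 0ℚ; ½; ∣_∣)
import Data.Rational.Properties as ℚ
open import Data.Rational.Solver using (module +-*-Solver)
open import Level using (0ℓ)
open import Relation.Binary.Core using (Rel)
open import Relation.Binary.Definitions using (Decidable; Irreflexive; Symmetric)
open import Relation.Binary.PropositionalEquality
  using (_≡_; _≢_; refl; sym; trans; cong; subst)
open import Relation.Nullary.Decidable using (_×-dec_)
open import Relation.Nullary.Negation.Core using (¬_)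

-- Real numbers as Cauchy sequences of rationals.  Two sequences represent the
-- same real when their difference tends to 0; the operations and the order below
-- respect this identification, so it need not be named.

IsCauchy : (ℕ → ℚ) → Set
IsCauchy x = ∀ ε → 0ℚ ℚ.< ε →
  ∃[ N ] ∀ p q → N ℕ.≤ p → N ℕ.≤ q → ∣ x p ℚ.- x q ∣ ℚ.< ε

record ℝ : Set where
  constructor mkℝ
  field
    seq    : ℕ → ℚ
    cauchy : IsCauchy seq

open ℝ public

private
  half-pos : ∀ {ε} → 0ℚ ℚ.< ε → 0ℚ ℚ.< ½ ℚ.* ε
  half-pos {ε} 0<ε = subst (λ q → q ℚ.< ½ ℚ.* ε) (ℚ.*-zeroʳ ½) (ℚ.*-monoʳ-<-pos ½ 0<ε)

  half+half : ∀ ε → ½ ℚ.* ε ℚ.+ ½ ℚ.* ε ≡ ε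
  half+half ε = trans (sym (ℚ.*-distribʳ-+ ε ½ ½)) (ℚ.*-identityˡ ε)

  sub-interchange : ∀ a b c d →
    (a ℚ.+ b) ℚ.- (c ℚ.+ d) ≡ (a ℚ.- c) ℚ.+ (b ℚ.- d)
  sub-interchange = solve 4
    (λ a b c d → (a :+ b) :- (c :+ d) := (a :- c) :+ (b :- d)) refl
    where open +-*-Solver

  neg-sub : ∀ a b → (ℚ.- a) ℚ.- (ℚ.- b) ≡ ℚ.- (a ℚ.- b)
  neg-sub = solve 2 (λ a b → (:- a) :- (:- b) := :- (a :- b)) refl
    where open +-*-Solver

  +-cauchy : ∀ x y → IsCauchy x → IsCauchy y → IsCauchy (λ n → x n ℚ.+ y n)
  +-cauchy x y cx cy ε 0<ε
    with M , hx ← cx (½ ℚ.* ε) (half-pos 0<ε)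
       | N , hy ← cy (½ ℚ.* ε) (half-pos 0<ε)
    = M ℕ.⊔ N , λ p q M⊔N≤p M⊔N≤q → begin-strict
        ∣ (x p ℚ.+ y p) ℚ.- (x q ℚ.+ y q) ∣
          ≡⟨ cong ∣_∣ (sub-interchange (x p) (y p) (x q) (y q)) ⟩
        ∣ (x p ℚ.- x q) ℚ.+ (y p ℚ.- y q) ∣
          ≤⟨ ℚ.∣p+q∣≤∣p∣+∣q∣ (x p ℚ.- x q) (y p ℚ.- y q) ⟩
        ∣ x p ℚ.- x q ∣ ℚ.+ ∣ y p ℚ.- y q ∣
          <⟨ ℚ.+-mono-<
               (hx p q (ℕ.m⊔n≤o⇒m≤o M N M⊔N≤p) (ℕ.m⊔n≤o⇒m≤o M N M⊔N≤q))
               (hy p q (ℕ.m⊔n≤o⇒n≤o M N M⊔N≤p) (ℕ.m⊔n≤o⇒n≤o M N M⊔N≤q)) ⟩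
        ½ ℚ.* ε ℚ.+ ½ ℚ.* ε
          ≡⟨ half+half ε ⟩
        ε ∎
    where open ℚ.≤-Reasoning

  neg-cauchy : ∀ x → IsCauchy x → IsCauchy (λ n → ℚ.- x n)
  neg-cauchy x cx ε 0<ε with N , hx ← cx ε 0<ε =
    N , λ p q N≤p N≤q → subst (ℚ._< ε)
      (sym (trans (cong ∣_∣ (neg-sub (x p) (x q))) (ℚ.∣-p∣≡∣p∣ (x p ℚ.- x q))))
      (hx p q N≤p N≤q)

infixl 6 _+_ _-_
infix  8 -_
infix  4 _<_ _≤_

0ℝ : ℝ
0ℝ = mkℝ (λ _ → 0ℚ) (λ _ 0<ε → 0 , λ _ _ _ _ → 0<ε)

_+_ : ℝ → ℝ → ℝ
x + y = mkℝ (λ n → seq x n ℚ.+ seq y n) (+-cauchy (seq x) (seq y) (cauchy x) (cauchy y))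

-_ : ℝ → ℝ
- x = mkℝ (λ n → ℚ.- seq x n) (neg-cauchy (seq x) (cauchy x))

_-_ : ℝ → ℝ → ℝ
x - y = x + (- y)

-- A termwise strict inequality would not respect equality of limits, so the
-- gap must eventually be bounded below by a positive rational.
_<_ : Rel ℝ 0ℓ
x < y = ∃[ ε ] 0ℚ ℚ.< ε × ∃[ N ] ∀ n → N ℕ.≤ n → seq x n ℚ.+ ε ℚ.≤ seq y n

_≤_ : Rel ℝ 0ℓ
x ≤ y = ¬ y < x

-- The vertex set {1,…,n} is represented by Fin n.
record Graph (n : ℕ) : Set₁ where
  field
    Adj       : Rel (Fin n) 0ℓ
    adj?      : Decidable Adj
    symmetric : Symmetric Adj
    loopless  : Irreflexive _≡_ Adj

module _ {n : ℕ} (G : Graph n) where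
  open Graph G

  neighbours : Fin n → List (Fin n)
  neighbours i = filter (adj? i) (allFin n)

  degree : Fin n → ℕ
  degree i = length (neighbours i)

  -- Each edge is listed once, with its smaller endpoint first.
  edges : List (Fin n × Fin n)
  edges = filter (λ (i , j) → (i Fin.<? j) ×-dec adj? i j)
                 (cartesianProduct (allFin n) (allFin n))

  IsThreshold : Set
  IsThreshold = ∀ i j k → i ≢ j → j ≢ k → i ≢ k →
    degree j ℕ.≤ degree i → Adj j k → Adj i k

𝔾 : ℕ → ℕ → Set₁
𝔾 n m = Σ[ G ∈ Graph n ] length (edges G) ≡ m

Σ[_] : (ℕ → ℝ) → ∀ {n} → (Fin n → ℕ) → ℝ
Σ[ f ] {n} d = foldr _+_ 0ℝ (map (λ i → f (d i)) (allFin n))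

Maximizes : (ℕ → ℝ) → ∀ {n m} → 𝔾 n m → Set₁
Maximizes f {n} {m} (G , _) =
  ((H , _) : 𝔾 n m) → Σ[ f ] (degree H) ≤ Σ[ f ] (degree G)

StrictlyConvex : (ℕ → ℝ) → Set
StrictlyConvex f = ∀ k →
  f (1 ℕ.+ k) - f k < f (2 ℕ.+ k) - f (1 ℕ.+ k)

{-# OPTIONS --safe #-}

-- If jk is an edge, ik is not, and dᵢ ≥ dⱼ, then replacing the edge jk by ik keeps
-- the number of edges, raises dᵢ by one, lowers dⱼ by one and fixes all other
-- degrees.  Hence Σ_f changes by (f(dᵢ+1) − f(dᵢ)) − (f(dⱼ) − f(dⱼ−1)), which is
-- positive by strict convexity since dⱼ−1 < dᵢ.

module Submission where

open import Defs
open import Data.Nat.Base using (ℕ)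
open import Data.Product.Base using (proj₁)

open import Algebra.Bundles using (CommutativeMonoid)
import Algebra.Properties.CommutativeMonoid.Sum as Sum
open import Data.Bool.Base using (if_then_else_; true; false)
open import Data.Bool.Properties using (∨-identityʳ)
open import Data.Fin.Base as Fin using (Fin; zero; suc)
import Data.Fin.Properties as Fin
open import Data.List.Base
  using (cartesianProduct; filter; foldr; length; map; tabulate; _++_)
open import Data.List.Properties using (filter-++; length-++; map-tabulate)
import Data.Nat.Base as ℕ
import Data.Nat.Properties as ℕ
open import Data.Product.Base using (_×_; _,_)
import Data.Rational.Base as ℚ
import Data.Rational.Properties as ℚ
open import Data.Rational.Solver using (module +-*-Solver)
open import Data.Sum.Base as Sum⊎ using (_⊎_; inj₁; inj₂; [_,_]′)
open import Data.Vec.Functional using (Vector)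
open import Function.Base using (_∘_; id)
open import Level using (0ℓ)
open import Relation.Binary.Core using (Rel)
open import Relation.Binary.Definitions
  using (Decidable; Irreflexive; Symmetric; tri<; tri≈; tri>)
open import Relation.Binary.PropositionalEquality
  using (_≡_; _≢_; refl; sym; trans; cong; cong₂; subst; subst₂; module ≡-Reasoning)
open import Relation.Nullary.Decidable
  using (Dec; yes; no; does; ¬?; _×-dec_; _⊎-dec_; decidable-stable)
open import Relation.Nullary.Negation using (¬_; contradiction)
open import Relation.Unary as U using (Pred)

open Graph

-- Finite sums in a commutative monoid: point masses and changes at two indices.

module _ {c ℓ} (M : CommutativeMonoid c ℓ) where
  open CommutativeMonoid M hiding (refl; sym) renaming (trans to ≈-trans)
  open Sum M
  open import Relation.Binary.Reasoning.Setoid setoid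

  δ : ∀ {n} → Fin n → Carrier → Vector Carrier n
  δ i x v = if does (v Fin.≟ i) then x else ε

  sum-δ : ∀ {n} (i : Fin n) x → sum (δ i x) ≈ x
  sum-δ {ℕ.suc n} zero    x = ≈-trans (∙-congˡ (sum-replicate-zero n)) (identityʳ x)
  sum-δ           (suc i) x = ≈-trans (identityˡ _) (sum-δ i x)

  sum-add-δδ : ∀ {n} (a : Vector Carrier n) i j x y →
    sum (λ v → a v ∙ (δ i x v ∙ δ j y v)) ≈ sum a ∙ (x ∙ y)
  sum-add-δδ a i j x y = begin
    sum (λ v → a v ∙ (δ i x v ∙ δ j y v))
      ≈⟨ ∑-distrib-+ a _ ⟩
    sum a ∙ sum (λ v → δ i x v ∙ δ j y v)
      ≈⟨ ∙-congˡ (∑-distrib-+ (δ i x) (δ j y)) ⟩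
    sum a ∙ (sum (δ i x) ∙ sum (δ j y))
      ≈⟨ ∙-congˡ (∙-cong (sum-δ i x) (sum-δ j y)) ⟩
    sum a ∙ (x ∙ y) ∎

  -- Cross-adding replaces subtraction, which a monoid does not have. Once `a` is corrected at `i`
  -- and `j` by the values of `b`, and `b` by those of `a`, the two functions agree pointwise; at
  -- `i` and `j` this is commutativity.
  sum-differ-at-two : ∀ {n} (a b : Vector Carrier n) {i j} → i ≢ j →
    (∀ v → v ≢ i → v ≢ j → a v ≈ b v) →
    sum a ∙ (b i ∙ b j) ≈ sum b ∙ (a i ∙ a j)
  sum-differ-at-two a b {i} {j} i≢j a≈b = begin
    sum a ∙ (b i ∙ b j)                            ≈⟨ sum-add-δδ a i j (b i) (b j) ⟨
    sum (λ v → a v ∙ (δ i (b i) v ∙ δ j (b j) v))  ≈⟨ sum-cong-≋ pointwise ⟩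
    sum (λ v → b v ∙ (δ i (a i) v ∙ δ j (a j) v))  ≈⟨ sum-add-δδ b i j (a i) (a j) ⟩
    sum b ∙ (a i ∙ a j)                            ∎
    where
    pointwise : ∀ v →
      a v ∙ (δ i (b i) v ∙ δ j (b j) v) ≈ b v ∙ (δ i (a i) v ∙ δ j (a j) v)
    pointwise v with v Fin.≟ i | v Fin.≟ j
    ... | yes refl | yes refl = contradiction refl i≢j
    ... | yes refl | no _     = begin
      a v ∙ (b v ∙ ε)  ≈⟨ ∙-congˡ (identityʳ _) ⟩
      a v ∙ b v        ≈⟨ comm _ _ ⟩
      b v ∙ a v        ≈⟨ ∙-congˡ (identityʳ _) ⟨
      b v ∙ (a v ∙ ε)  ∎
    ... | no _     | yes refl = begin
      a v ∙ (ε ∙ b v)  ≈⟨ ∙-congˡ (identityˡ _) ⟩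
      a v ∙ b v        ≈⟨ comm _ _ ⟩
      b v ∙ a v        ≈⟨ ∙-congˡ (identityˡ _) ⟨
      b v ∙ (ε ∙ a v)  ∎
    ... | no v≢i   | no v≢j   = ∙-congʳ (a≈b v v≢i v≢j)

-- Degrees and edge counts as sums of indicators, and the handshake identity.

open Sum ℕ.+-0-commutativeMonoid

-- Only the Boolean part of the decision matters, so `𝟙 (v Fin.≟ i)` is definitionally the point
-- mass `δ i 1 v` over the naturals.
𝟙 : ∀ {p} {P : Set p} → Dec P → ℕ
𝟙 P? = if does P? then 1 else 0

length-filter-tabulate : ∀ {a p} {A : Set a} {P : Pred A p} (P? : U.Decidable P)
  {n} (g : Fin n → A) →
  length (filter P? (tabulate g)) ≡ ∑[ v < n ] 𝟙 (P? (g v))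
length-filter-tabulate P? {ℕ.zero}  g = refl
length-filter-tabulate P? {ℕ.suc n} g with does (P? (g zero))
... | true  = cong ℕ.suc (length-filter-tabulate P? (g ∘ suc))
... | false = length-filter-tabulate P? (g ∘ suc)

length-filter-cartesianProduct : ∀ {a b p} {A : Set a} {B : Set b} {P : Pred (A × B) p}
  (P? : U.Decidable P) {m n} (g : Fin m → A) (h : Fin n → B) →
  length (filter P? (cartesianProduct (tabulate g) (tabulate h)))
    ≡ ∑[ u < m ] ∑[ v < n ] 𝟙 (P? (g u , h v))
length-filter-cartesianProduct P? {ℕ.zero}      g h = refl
length-filter-cartesianProduct P? {ℕ.suc m} {n} g h = begin
  length (filter P? (row ++ rest))
    ≡⟨ cong length (filter-++ P? row rest) ⟩
  length (filter P? row ++ filter P? rest)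
    ≡⟨ length-++ (filter P? row) ⟩
  length (filter P? row) ℕ.+ length (filter P? rest)
    ≡⟨ cong₂ ℕ._+_
         (trans (cong (length ∘ filter P?) (map-tabulate h (g zero ,_)))
                (length-filter-tabulate P? (λ v → g zero , h v)))
         (length-filter-cartesianProduct P? (g ∘ suc) h) ⟩
  ∑[ u < ℕ.suc m ] ∑[ v < n ] 𝟙 (P? (g u , h v)) ∎
  where
  open ≡-Reasoning
  row  = map (g zero ,_) (tabulate h)
  rest = cartesianProduct (tabulate (g ∘ suc)) (tabulate h)

degree-sum : ∀ {n} (G : Graph n) u → degree G u ≡ ∑[ v < n ] 𝟙 (adj? G u v)
degree-sum G u = length-filter-tabulate (adj? G u) id

-- Meant for adjacency of a pair read in both orders (`A`, `B`) and the two strict comparisons of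
-- its endpoints (`C`, `D`): an adjacent pair satisfies exactly one comparison, and a non-adjacent
-- one contributes zero on both sides.
𝟙-split : ∀ {a b c d} {A : Set a} {B : Set b} {C : Set c} {D : Set d} →
  (A? : Dec A) (B? : Dec B) (C? : Dec C) (D? : Dec D) →
  (A → B) → (B → A) → (C → ¬ D) → (A → ¬ C → D) →
  𝟙 A? ≡ 𝟙 (C? ×-dec A?) ℕ.+ 𝟙 (D? ×-dec B?)
𝟙-split (yes a) (no ¬b) _       _       A⊆B B⊆A C∩D cover = contradiction (A⊆B a) ¬b
𝟙-split (no ¬a) (yes b) _       _       A⊆B B⊆A C∩D cover = contradiction (B⊆A b) ¬a
𝟙-split (yes _) (yes _) (yes c) (yes d) A⊆B B⊆A C∩D cover = contradiction d (C∩D c)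
𝟙-split (yes a) (yes _) (no ¬c) (no ¬d) A⊆B B⊆A C∩D cover = contradiction (cover a ¬c) ¬d
𝟙-split (yes _) (yes _) (yes _) (no _)  A⊆B B⊆A C∩D cover = refl
𝟙-split (yes _) (yes _) (no _)  (yes _) A⊆B B⊆A C∩D cover = refl
𝟙-split (no _)  (no _)  (yes _) (yes _) A⊆B B⊆A C∩D cover = refl
𝟙-split (no _)  (no _)  (yes _) (no _)  A⊆B B⊆A C∩D cover = refl
𝟙-split (no _)  (no _)  (no _)  (yes _) A⊆B B⊆A C∩D cover = refl
𝟙-split (no _)  (no _)  (no _)  (no _)  A⊆B B⊆A C∩D cover = refl

-- Every ordered adjacent pair is either increasing or decreasing; exchanging the order of summation
-- turns the decreasing count into the increasing one, which counts `edges`. It makes the number of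
-- edges a function of the degree sequence.
handshake : ∀ {n} (G : Graph n) →
  ∑[ u < n ] degree G u ≡ length (edges G) ℕ.+ length (edges G)
handshake {n} G = begin
  ∑[ u < n ] degree G u
    ≡⟨ sum-cong-≗ (degree-sum G) ⟩
  ∑[ u < n ] ∑[ v < n ] 𝟙 (adj? G u v)
    ≡⟨ sum-cong-≗ (λ u → sum-cong-≗ (orient u)) ⟩
  ∑[ u < n ] ∑[ v < n ] (o u v ℕ.+ o v u)
    ≡⟨ sum-cong-≗ (λ u → ∑-distrib-+ (o u) (λ v → o v u)) ⟩
  ∑[ u < n ] (∑[ v < n ] o u v ℕ.+ ∑[ v < n ] o v u)
    ≡⟨ ∑-distrib-+ (λ u → ∑[ v < n ] o u v) (λ u → ∑[ v < n ] o v u) ⟩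
  ∑[ u < n ] ∑[ v < n ] o u v ℕ.+ ∑[ u < n ] ∑[ v < n ] o v u
    ≡⟨ cong (∑[ u < n ] ∑[ v < n ] o u v ℕ.+_) (∑-comm (λ u v → o v u)) ⟩
  ∑[ u < n ] ∑[ v < n ] o u v ℕ.+ ∑[ u < n ] ∑[ v < n ] o u v
    ≡⟨ cong (λ e → e ℕ.+ e) (sym e≡) ⟩
  length (edges G) ℕ.+ length (edges G) ∎
  where
  open ≡-Reasoning
  o : Fin n → Fin n → ℕ
  o u v = 𝟙 ((u Fin.<? v) ×-dec adj? G u v)

  e≡ : length (edges G) ≡ ∑[ u < n ] ∑[ v < n ] o u v
  e≡ = length-filter-cartesianProduct (λ (u , v) → (u Fin.<? v) ×-dec adj? G u v) id id

  orient : ∀ u v → 𝟙 (adj? G u v) ≡ o u v ℕ.+ o v u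
  orient u v = 𝟙-split (adj? G u v) (adj? G v u) (u Fin.<? v) (v Fin.<? u)
    (symmetric G) (symmetric G) Fin.<-asym
    -- Looplessness excludes equal endpoints, so failure of `u < v` leaves only `v < u`.
    (λ uv u≮v → Fin.≤∧≢⇒< (ℕ.≮⇒≥ u≮v) (λ v≡u → loopless G (sym v≡u) uv))

-- The graph with the single edge ab.

module _ {n : ℕ} where

  Joins : Fin n → Fin n → Rel (Fin n) 0ℓ
  Joins a b u v = (u ≡ a × v ≡ b) ⊎ (u ≡ b × v ≡ a)

  joins? : ∀ a b → Decidable (Joins a b)
  joins? a b u v = (u Fin.≟ a ×-dec v Fin.≟ b) ⊎-dec (u Fin.≟ b ×-dec v Fin.≟ a)

  joins-sym : ∀ {a b} → Symmetric (Joins a b)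
  joins-sym (inj₁ (p , q)) = inj₂ (q , p)
  joins-sym (inj₂ (p , q)) = inj₁ (q , p)

  joins-irrefl : ∀ {a b} → a ≢ b → Irreflexive _≡_ (Joins a b)
  joins-irrefl a≢b refl (inj₁ (p , q)) = a≢b (trans (sym p) q)
  joins-irrefl a≢b refl (inj₂ (p , q)) = a≢b (trans (sym q) p)

  joins-degree : ∀ {a b} → a ≢ b → ∀ u →
    ∑[ v < n ] 𝟙 (joins? a b u v) ≡ 𝟙 (u Fin.≟ a) ℕ.+ 𝟙 (u Fin.≟ b)
  joins-degree {a} {b} a≢b u with u Fin.≟ a | u Fin.≟ b
  ... | yes u≡a | yes u≡b = contradiction (trans (sym u≡a) u≡b) a≢b
  ... | yes _   | no _    = trans
    -- For `u` equal to `a` the second disjunct is false, and the row reduces to the point mass at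
    -- `b`.
    (sum-cong-≗ (λ v → cong (if_then 1 else 0) (∨-identityʳ (does (v Fin.≟ b)))))
    (sum-δ ℕ.+-0-commutativeMonoid b 1)
  ... | no _    | yes _   = sum-δ ℕ.+-0-commutativeMonoid a 1
  ... | no _    | no _    = sum-replicate-zero n

-- Here `B` is deleted from `A` and `C` inserted. Since `B` lies inside `A` and `C` outside it, each
-- change counts in full; adding `B` on the left avoids truncated subtraction.
𝟙-exchange : ∀ {a b c} {A : Set a} {B : Set b} {C : Set c} →
  (A? : Dec A) (B? : Dec B) (C? : Dec C) → (B → A) → (C → ¬ A) →
  𝟙 ((A? ×-dec ¬? B?) ⊎-dec C?) ℕ.+ 𝟙 B? ≡ 𝟙 A? ℕ.+ 𝟙 C?
𝟙-exchange (yes a) _       (yes c) B⊆A C∩A = contradiction a (C∩A c)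
𝟙-exchange (no ¬a) (yes b) _       B⊆A C∩A = contradiction (B⊆A b) ¬a
𝟙-exchange (yes _) (yes _) (no _)  B⊆A C∩A = refl
𝟙-exchange (yes _) (no _)  (no _)  B⊆A C∩A = refl
𝟙-exchange (no _)  (no _)  (yes _) B⊆A C∩A = refl
𝟙-exchange (no _)  (no _)  (no _)  B⊆A C∩A = refl

-- Replacing the edge jk by ik: effect on degrees and edge count.

module Rewire {n : ℕ} (G : Graph n) {i j k : Fin n}
  (i≢j : i ≢ j) (j≢k : j ≢ k) (i≢k : i ≢ k)
  (jk : Adj G j k) (¬ik : ¬ Adj G i k) where

  rewired : Graph n
  rewired = record
    { Adj       = λ u v → (Adj G u v × ¬ Joins j k u v) ⊎ Joins i k u v
    ; adj?      = λ u v → (adj? G u v ×-dec ¬? (joins? j k u v)) ⊎-dec joins? i k u v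
    ; symmetric = Sum⊎.map (λ (uv , ¬jk) → symmetric G uv , ¬jk ∘ joins-sym) joins-sym
    ; loopless  = λ u≡v → [ loopless G u≡v ∘ proj₁ , joins-irrefl i≢k u≡v ]′
    }

  degree-rewired : ∀ u →
    degree rewired u ℕ.+ 𝟙 (u Fin.≟ j) ≡ degree G u ℕ.+ 𝟙 (u Fin.≟ i)
  -- Vertex `k` is an endpoint of both the deleted and the inserted edge, so its indicator occurs on
  -- both sides and cancels.
  degree-rewired u = ℕ.+-cancelʳ-≡ (𝟙 (u Fin.≟ k)) _ _ (begin
    degree rewired u ℕ.+ 𝟙 (u Fin.≟ j) ℕ.+ 𝟙 (u Fin.≟ k)
      ≡⟨ ℕ.+-assoc (degree rewired u) _ _ ⟩
    degree rewired u ℕ.+ (𝟙 (u Fin.≟ j) ℕ.+ 𝟙 (u Fin.≟ k))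
      ≡⟨ cong₂ ℕ._+_ (degree-sum rewired u) (sym (joins-degree j≢k u)) ⟩
    ∑[ v < n ] 𝟙 (adj? rewired u v) ℕ.+ ∑[ v < n ] 𝟙 (joins? j k u v)
      ≡⟨ ∑-distrib-+ (λ v → 𝟙 (adj? rewired u v)) (λ v → 𝟙 (joins? j k u v)) ⟨
    ∑[ v < n ] (𝟙 (adj? rewired u v) ℕ.+ 𝟙 (joins? j k u v))
      ≡⟨ sum-cong-≗ (λ v → 𝟙-exchange (adj? G u v) (joins? j k u v) (joins? i k u v)
                             joins-jk⇒adj joins-ik⇒¬adj) ⟩
    ∑[ v < n ] (𝟙 (adj? G u v) ℕ.+ 𝟙 (joins? i k u v))
      ≡⟨ ∑-distrib-+ (λ v → 𝟙 (adj? G u v)) (λ v → 𝟙 (joins? i k u v)) ⟩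
    ∑[ v < n ] 𝟙 (adj? G u v) ℕ.+ ∑[ v < n ] 𝟙 (joins? i k u v)
      ≡⟨ cong₂ ℕ._+_ (sym (degree-sum G u)) (joins-degree i≢k u) ⟩
    degree G u ℕ.+ (𝟙 (u Fin.≟ i) ℕ.+ 𝟙 (u Fin.≟ k))
      ≡⟨ ℕ.+-assoc (degree G u) _ _ ⟨
    degree G u ℕ.+ 𝟙 (u Fin.≟ i) ℕ.+ 𝟙 (u Fin.≟ k) ∎)
    where
    open ≡-Reasoning
    joins-jk⇒adj : ∀ {v} → Joins j k u v → Adj G u v
    joins-jk⇒adj (inj₁ (refl , refl)) = jk
    joins-jk⇒adj (inj₂ (refl , refl)) = symmetric G jk
    joins-ik⇒¬adj : ∀ {v} → Joins i k u v → ¬ Adj G u v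
    joins-ik⇒¬adj (inj₁ (refl , refl)) = ¬ik
    joins-ik⇒¬adj (inj₂ (refl , refl)) = ¬ik ∘ symmetric G

  degree-rewired-i : degree rewired i ≡ ℕ.suc (degree G i)
  degree-rewired-i with i Fin.≟ j | i Fin.≟ i | degree-rewired i
  ... | yes i≡j | _      | _  = contradiction i≡j i≢j
  ... | no _    | no i≢i | _  = contradiction refl i≢i
  ... | no _    | yes _  | eq =
    trans (sym (ℕ.+-identityʳ _)) (trans eq (ℕ.+-comm _ 1))

  degree-rewired-j : degree G j ≡ ℕ.suc (degree rewired j)
  degree-rewired-j with j Fin.≟ j | j Fin.≟ i | degree-rewired j
  ... | _      | yes j≡i | _  = contradiction (sym j≡i) i≢j
  ... | no j≢j | _       | _  = contradiction refl j≢j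
  ... | yes _  | no _    | eq =
    trans (sym (ℕ.+-identityʳ _)) (trans (sym eq) (ℕ.+-comm _ 1))

  degree-rewired-other : ∀ u → u ≢ i → u ≢ j → degree G u ≡ degree rewired u
  degree-rewired-other u u≢i u≢j with u Fin.≟ j | u Fin.≟ i | degree-rewired u
  ... | yes u≡j | _       | _  = contradiction u≡j u≢j
  ... | no _    | yes u≡i | _  = contradiction u≡i u≢i
  ... | no _    | no _    | eq = sym (ℕ.+-cancelʳ-≡ 0 _ _ eq)

  -- Summing `degree-rewired` over all vertices adds 1 to each side, so the degree sums agree; by
  -- the handshake identity twice the edge counts agree.
  length-edges-rewired : length (edges rewired) ≡ length (edges G)
  length-edges-rewired = double-injective (begin
    length (edges rewired) ℕ.+ length (edges rewired)
      ≡⟨ handshake rewired ⟨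
    sum (degree rewired)
      ≡⟨ ℕ.+-cancelʳ-≡ 1 _ _ sum-degrees+1 ⟩
    sum (degree G)
      ≡⟨ handshake G ⟩
    length (edges G) ℕ.+ length (edges G) ∎)
    where
    open ≡-Reasoning
    double-injective : ∀ {a b} → a ℕ.+ a ≡ b ℕ.+ b → a ≡ b
    double-injective {a} {b} eq with ℕ.<-cmp a b
    ... | tri< a<b _ _ = contradiction eq (ℕ.<⇒≢ (ℕ.+-mono-< a<b a<b))
    ... | tri≈ _ a≡b _ = a≡b
    ... | tri> _ _ b<a = contradiction (sym eq) (ℕ.<⇒≢ (ℕ.+-mono-< b<a b<a))
    sum+1 : (d : Vector ℕ n) (v : Fin n) → ∑[ u < n ] (d u ℕ.+ 𝟙 (u Fin.≟ v)) ≡ sum d ℕ.+ 1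
    sum+1 d v = trans (∑-distrib-+ d (λ u → 𝟙 (u Fin.≟ v)))
                      (cong (sum d ℕ.+_) (sum-δ ℕ.+-0-commutativeMonoid v 1))
    sum-degrees+1 : sum (degree rewired) ℕ.+ 1 ≡ sum (degree G) ℕ.+ 1
    sum-degrees+1 = begin
      sum (degree rewired) ℕ.+ 1                        ≡⟨ sum+1 (degree rewired) j ⟨
      ∑[ u < n ] (degree rewired u ℕ.+ 𝟙 (u Fin.≟ j))   ≡⟨ sum-cong-≗ degree-rewired ⟩
      ∑[ u < n ] (degree G u ℕ.+ 𝟙 (u Fin.≟ i))         ≡⟨ sum+1 (degree G) i ⟩
      sum (degree G) ℕ.+ 1                              ∎

-- The strict order on the reals and increasing sequences.

<-trans : ∀ {x y z} → x < y → y < z → x < z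
<-trans {x} {y} {z} (ε , 0<ε , M , x<y) (ε′ , 0<ε′ , N , y<z) =
  -- The margin of the first inequality already suffices; that of the second is only used as being
  -- nonnegative.
  ε , 0<ε , M ℕ.⊔ N , λ n M⊔N≤n → begin
    seq x n ℚ.+ ε     ≤⟨ x<y n (ℕ.m⊔n≤o⇒m≤o M N M⊔N≤n) ⟩
    seq y n           ≡⟨ ℚ.+-identityʳ _ ⟨
    seq y n ℚ.+ ℚ.0ℚ  ≤⟨ ℚ.+-monoʳ-≤ (seq y n) (ℚ.<⇒≤ 0<ε′) ⟩
    seq y n ℚ.+ ε′    ≤⟨ y<z n (ℕ.m⊔n≤o⇒n≤o M N M⊔N≤n) ⟩
    seq z n           ∎
  where open ℚ.≤-Reasoning

increasing : (g : ℕ → ℝ) → (∀ k → g k < g (ℕ.suc k)) → ∀ {k l} → k ℕ.<′ l → g k < g l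
increasing g step ℕ.<′-base       = step _
increasing g step (ℕ.<′-step k<l) = <-trans {g _} {g _} {g _} (increasing g step k<l) (step _)

-- Comparing sums of `f` through rational approximations.

module ℚΣ = Sum ℚ.+-0-commutativeMonoid

-- Real addition is termwise, so the comparison of two such sums reduces to finite sums of rationals
-- at each index `N`.
seq-Σ : ∀ (f : ℕ → ℝ) {n} (d : Fin n → ℕ) N →
  seq (Σ[ f ] d) N ≡ ℚΣ.sum (λ v → seq (f (d v)) N)
seq-Σ f d N = trans (cong (λ xs → seq (foldr _+_ 0ℝ xs) N) (map-tabulate id (f ∘ d)))
                    (seq-foldr-tabulate (f ∘ d))
  where
  seq-foldr-tabulate : ∀ {n} (x : Fin n → ℝ) →
    seq (foldr _+_ 0ℝ (tabulate x)) N ≡ ℚΣ.sum (λ v → seq (x v) N)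
  seq-foldr-tabulate {ℕ.zero}  x = refl
  seq-foldr-tabulate {ℕ.suc n} x = cong (seq (x zero) N ℚ.+_) (seq-foldr-tabulate (x ∘ suc))

-- With `s`, `t` the sums before and after the exchange, the equation says that `t - s` is
-- `(a′ - a) - (b - b′)`, and the second hypothesis bounds this below by `ε`.
exchange-≤ : ∀ s t a a′ b b′ ε → s ℚ.+ (a′ ℚ.+ b′) ≡ t ℚ.+ (a ℚ.+ b) →
  (b ℚ.- b′) ℚ.+ ε ℚ.≤ a′ ℚ.- a → s ℚ.+ ε ℚ.≤ t
exchange-≤ s t a a′ b b′ ε eq gap = begin
  s ℚ.+ ε
    ≡⟨ solve 6 (λ s a a′ b b′ ε → s :+ ε :=
         (s :+ (a′ :+ b′)) :- (a′ :+ b) :+ ((b :- b′) :+ ε)) refl s a a′ b b′ ε ⟩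
  (s ℚ.+ (a′ ℚ.+ b′)) ℚ.- (a′ ℚ.+ b) ℚ.+ ((b ℚ.- b′) ℚ.+ ε)
    ≤⟨ ℚ.+-monoʳ-≤ ((s ℚ.+ (a′ ℚ.+ b′)) ℚ.- (a′ ℚ.+ b)) gap ⟩
  (s ℚ.+ (a′ ℚ.+ b′)) ℚ.- (a′ ℚ.+ b) ℚ.+ (a′ ℚ.- a)
    ≡⟨ cong (λ q → q ℚ.- (a′ ℚ.+ b) ℚ.+ (a′ ℚ.- a)) eq ⟩
  (t ℚ.+ (a ℚ.+ b)) ℚ.- (a′ ℚ.+ b) ℚ.+ (a′ ℚ.- a)
    ≡⟨ solve 4 (λ t a a′ b →
         (t :+ (a :+ b)) :- (a′ :+ b) :+ (a′ :- a) := t) refl t a a′ b ⟩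
  t ∎
  where
  open ℚ.≤-Reasoning
  open +-*-Solver

theorem2 : (f : ℕ → ℝ) → StrictlyConvex f →
    ∀ {n m : ℕ} (G : 𝔾 n m) → Maximizes f G → IsThreshold (proj₁ G)
theorem2 f convex (G , e≡m) maximal i j k i≢j j≢k i≢k dj≤di jk =
  -- Adjacency is decidable, so it suffices to refute the absence of the edge ik.
  decidable-stable (adj? G i k) λ ¬ik →
    let open Rewire G i≢j j≢k i≢k jk ¬ik
        -- Strict convexity makes the first differences of `f` increase. They are compared at the
        -- new degree of `j` and the old degree of `i`; the former is smaller because it is one
        -- below the old degree of `j`.
        ε , 0<ε , N , gap = increasing (λ l → f (ℕ.suc l) - f l) convex
          (ℕ.<⇒<′ (subst (ℕ._≤ degree G i) degree-rewired-j dj≤di))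
        improved : Σ[ f ] (degree G) < Σ[ f ] (degree rewired)
        -- The margin and threshold index for the two first differences serve unchanged for the
        -- sums, which differ only in the terms at `i` and `j`.
        improved = ε , 0<ε , N , λ p N≤p →
          let F = λ d → seq (f d) p in
          subst₂ (λ s t → s ℚ.+ ε ℚ.≤ t)
            (sym (seq-Σ f (degree G) p)) (sym (seq-Σ f (degree rewired) p))
            (exchange-≤ (ℚΣ.sum (F ∘ degree G)) (ℚΣ.sum (F ∘ degree rewired))
              (F (degree G i)) (F (degree rewired i)) (F (degree G j)) (F (degree rewired j)) ε
              (sum-differ-at-two ℚ.+-0-commutativeMonoid
                (F ∘ degree G) (F ∘ degree rewired) i≢j
                (λ u u≢i u≢j → cong F (degree-rewired-other u u≢i u≢j)))
              (subst₂ (λ a′ b → (F b ℚ.- F (degree rewired j)) ℚ.+ ε ℚ.≤ F a′ ℚ.- F (degree G i))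
                (sym degree-rewired-i) (sym degree-rewired-j) (gap p N≤p)))
    -- The order `≤` is the negation of the reversed `<`, so maximality refutes `improved` directly.
    in maximal (rewired , trans length-edges-rewired e≡m) improved
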